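{- Let $\mathcal{F}$ be the collection of all finite subsets of $\mathbb{N}$. Let $f:\mathcal{F}\to\mathbb{C}$ be a function that is not identically zero and let $g:\mathcal{F}\to\mathbb{C}$ be given by $$g(y)=\sum_{x\subseteq y} f(x)\qquad (y\in\mathcal{F}),$$ so that $$f(y)=\sum_{x\subseteq y}(-1)^{|y|-|x|}g(x)\qquad (y\in\mathcal{F}).$$ Then the support of $f$ and the support of $g$ cannot both be finite.
   Context: The support of a function $h:\mathcal{F}\to\mathbb{C}$ is the set $\{x\in\mathcal{F}: h(x)\neq 0\}$. The sums range over all subsets $x$ of the finite set $y$, and $|x|$ denotes the cardinality of $x$. -}

module Defs where

open import Level using (0ℓ)
open import Algebra.Bundles using (CommutativeRing)
open import Algebra.Structures using (IsCommutativeRing)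
open import Data.Nat.Base as ℕ using (ℕ; zero; suc)
import Data.Nat.Properties as ℕ
open import Data.Integer.Base using (+_)
open import Data.Rational.Base as ℚ using (ℚ; 0ℚ; 1ℚ; ½; ∣_∣)
import Data.Rational.Properties as ℚ
open import Data.Rational.Solver using (module +-*-Solver)
open import Data.Empty using (⊥-elim)
open import Data.Product.Base using (Σ; ∃; _×_; _,_; proj₁; proj₂)
open import Data.Sum.Base using (inj₁; inj₂)
open import Data.List.Base using (List; []; _∷_; _++_; map; foldr)
open import Data.List.Membership.Propositional using () renaming (_∈_ to _∈ₗ_)
open import Data.List.Membership.Propositional.Properties using (∈-++⁺ˡ; ∈-++⁺ʳ; ∈-++⁻)
open import Data.List.Relation.Unary.Any using (here; there)
open import Data.List.Relation.Unary.All as All using (All; []; _∷_)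
import Data.List.Relation.Unary.All.Properties as All
open import Data.List.Relation.Unary.AllPairs using ([]; _∷_)
open import Data.List.Relation.Unary.Unique.Propositional using (Unique)
import Data.List.Relation.Unary.Unique.Propositional.Properties as Unique
open import Data.List.Fresh as Fresh using (List#; module List#)
open import Data.List.Fresh.Relation.Unary.Any using (here; there)
open List# using ([]; cons)
import Data.List.Fresh.Membership.Setoid as FreshMembership
open import Relation.Binary.PropositionalEquality
  using (_≡_; refl; sym; trans; cong; cong₂; subst; subst₂; setoid)
open import Relation.Binary.Definitions using (Irrelevant)
open import Relation.Nullary.Negation.Core using (¬_; contradiction)
open import Relation.Unary using (Pred)

------------------------------------------------------------------------
-- The real numbers, as Cauchy sequences of rationals. There is no quotient:
-- two sequences represent the same real when they are related by _≈_.

module Real where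

  Cauchy : (ℕ → ℚ) → Set
  Cauchy s = ∀ ε → 0ℚ ℚ.< ε →
             ∃ λ N → ∀ m n → N ℕ.≤ m → N ℕ.≤ n → ∣ s m ℚ.- s n ∣ ℚ.< ε

  record ℝ : Set where
    no-eta-equality
    constructor mkℝ
    field
      seq    : ℕ → ℚ
      cauchy : Cauchy seq

  open ℝ public

  infix 4 _≈_

  -- A record, so that x and y can be recovered from x ≈ y by unification.
  record _≈_ (x y : ℝ) : Set where
    constructor mk≈
    field
      close : ∀ ε → 0ℚ ℚ.< ε →
              ∃ λ N → ∀ n → N ℕ.≤ n → ∣ seq x n ℚ.- seq y n ∣ ℚ.< ε

  open _≈_ public

  private
    open +-*-Solver

    half : ∀ ε → ½ ℚ.* ε ℚ.+ ½ ℚ.* ε ≡ ε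
    half ε = trans (sym (ℚ.*-distribʳ-+ ε ½ ½)) (ℚ.*-identityˡ ε)

    half>0 : ∀ {ε} → 0ℚ ℚ.< ε → 0ℚ ℚ.< ½ ℚ.* ε
    half>0 {ε} ε>0 = subst (ℚ._< ½ ℚ.* ε) (ℚ.*-zeroʳ ½) (ℚ.*-monoʳ-<-pos ½ ε>0)

    ∣self∣ : ∀ p → ∣ p ℚ.- p ∣ ≡ 0ℚ
    ∣self∣ p = cong ∣_∣ (ℚ.+-inverseʳ p)

    ∣swap∣ : ∀ p q → ∣ p ℚ.- q ∣ ≡ ∣ q ℚ.- p ∣
    ∣swap∣ p q = trans (cong ∣_∣ (solve 2 (λ p q → p :- q := :- (q :- p)) refl p q))
                       (ℚ.∣-p∣≡∣p∣ (q ℚ.- p))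

    halves : ∀ {p q ε} → ∣ p ∣ ℚ.< ½ ℚ.* ε → ∣ q ∣ ℚ.< ½ ℚ.* ε → ∣ p ℚ.+ q ∣ ℚ.< ε
    halves {p} {q} {ε} p< q< = ℚ.≤-<-trans (ℚ.∣p+q∣≤∣p∣+∣q∣ p q)
      (subst (∣ p ∣ ℚ.+ ∣ q ∣ ℚ.<_) (half ε) (ℚ.+-mono-< p< q<))

    triangle-close : ∀ a b c {ε} → ∣ a ℚ.- b ∣ ℚ.< ½ ℚ.* ε → ∣ b ℚ.- c ∣ ℚ.< ½ ℚ.* ε →
                     ∣ a ℚ.- c ∣ ℚ.< ε
    triangle-close a b c {ε} p q = subst (λ t → ∣ t ∣ ℚ.< ε)
      (solve 3 (λ a b c → (a :- b) :+ (b :- c) := a :- c) refl a b c) (halves p q)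

    +-close : ∀ a b c d {ε} → ∣ a ℚ.- c ∣ ℚ.< ½ ℚ.* ε → ∣ b ℚ.- d ∣ ℚ.< ½ ℚ.* ε →
              ∣ (a ℚ.+ b) ℚ.- (c ℚ.+ d) ∣ ℚ.< ε
    +-close a b c d {ε} p q = subst (λ t → ∣ t ∣ ℚ.< ε)
      (solve 4 (λ a b c d → (a :- c) :+ (b :- d) := (a :+ b) :- (c :+ d)) refl a b c d)
      (halves p q)

    neg-close : ∀ a b {ε} → ∣ a ℚ.- b ∣ ℚ.< ε → ∣ ℚ.- a ℚ.- ℚ.- b ∣ ℚ.< ε
    neg-close a b {ε} = subst (ℚ._< ε) (trans (∣swap∣ a b)
      (cong ∣_∣ (solve 2 (λ a b → b :- a := :- a :- :- b) refl a b)))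

    ∣*∣-bound : ∀ p q {A δ} → ∣ p ∣ ℚ.< A → ∣ q ∣ ℚ.< δ → ∣ p ℚ.* q ∣ ℚ.< A ℚ.* δ
    ∣*∣-bound p q {A} {δ} p<A q<δ = subst (ℚ._< A ℚ.* δ) (sym (ℚ.∣p*q∣≡∣p∣*∣q∣ p q))
      (ℚ.≤-<-trans (ℚ.*-monoʳ-≤-nonNeg ∣ q ∣ {{ℚ.nonNegative (ℚ.0≤∣p∣ q)}} (ℚ.<⇒≤ p<A))
                   (ℚ.*-monoʳ-<-pos A {{ℚ.positive (ℚ.≤-<-trans (ℚ.0≤∣p∣ p) p<A)}} q<δ))

    *-close : ∀ a b c d {A D δ ε} → ∣ a ∣ ℚ.< A → ∣ d ∣ ℚ.< D → (A ℚ.+ D) ℚ.* δ ≡ ε →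
              ∣ a ℚ.- c ∣ ℚ.< δ → ∣ b ℚ.- d ∣ ℚ.< δ → ∣ a ℚ.* b ℚ.- c ℚ.* d ∣ ℚ.< ε
    *-close a b c d {A} {D} {δ} {ε} a<A d<D eq ac bd = subst₂ (λ s t → ∣ s ∣ ℚ.< t)
      (solve 4 (λ a b c d → a :* (b :- d) :+ d :* (a :- c) := a :* b :- c :* d) refl a b c d)
      (trans (sym (ℚ.*-distribʳ-+ δ A D)) eq)
      (ℚ.≤-<-trans (ℚ.∣p+q∣≤∣p∣+∣q∣ (a ℚ.* (b ℚ.- d)) (d ℚ.* (a ℚ.- c)))
                   (ℚ.+-mono-< (∣*∣-bound a (b ℚ.- d) a<A bd) (∣*∣-bound d (a ℚ.- c) d<D ac)))

    bounded : ∀ x → ∃ λ B → ∃ λ N → ∀ n → N ℕ.≤ n → ∣ seq x n ∣ ℚ.< B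
    bounded x with cauchy x 1ℚ (ℚ.positive⁻¹ 1ℚ)
    ... | N , close₁ = 1ℚ ℚ.+ ∣ seq x N ∣ , N , λ n N≤n →
      ℚ.≤-<-trans
        (subst (λ t → ∣ t ∣ ℚ.≤ ∣ seq x n ℚ.- seq x N ∣ ℚ.+ ∣ seq x N ∣)
          (solve 2 (λ a b → (a :- b) :+ b := a) refl (seq x n) (seq x N))
          (ℚ.∣p+q∣≤∣p∣+∣q∣ (seq x n ℚ.- seq x N) (seq x N)))
        (ℚ.+-monoˡ-< ∣ seq x N ∣ (close₁ n N N≤n ℕ.≤-refl))

    divide : ∀ {C ε} → 0ℚ ℚ.< C → 0ℚ ℚ.< ε → ∃ λ δ → 0ℚ ℚ.< δ × C ℚ.* δ ≡ ε
    divide {C} {ε} C>0 ε>0 = C⁻¹ ℚ.* ε ,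
      subst (ℚ._< C⁻¹ ℚ.* ε) (ℚ.*-zeroʳ C⁻¹) (ℚ.*-monoʳ-<-pos C⁻¹ ε>0) ,
      trans (sym (ℚ.*-assoc C C⁻¹ ε))
            (trans (cong (ℚ._* ε) (ℚ.*-inverseʳ C)) (ℚ.*-identityˡ ε))
      where
      instance
        C-pos : ℚ.Positive C
        C-pos = ℚ.positive C>0
        C-nonZero : ℚ.NonZero C
        C-nonZero = ℚ.pos⇒nonZero C
      C⁻¹ : ℚ
      C⁻¹ = ℚ.1/ C
      instance
        C⁻¹-pos : ℚ.Positive C⁻¹
        C⁻¹-pos = ℚ.1/pos⇒pos C

    pos-bounds : ∀ {a d A D} → ∣ a ∣ ℚ.< A → ∣ d ∣ ℚ.< D → 0ℚ ℚ.< A ℚ.+ D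
    pos-bounds {a} {d} a<A d<D =
      ℚ.+-mono-< (ℚ.≤-<-trans (ℚ.0≤∣p∣ a) a<A) (ℚ.≤-<-trans (ℚ.0≤∣p∣ d) d<D)

    ⊔₁ : ∀ {k l n} → k ℕ.⊔ l ℕ.≤ n → k ℕ.≤ n
    ⊔₁ {k} {l} = ℕ.≤-trans (ℕ.m≤m⊔n k l)

    ⊔₂ : ∀ {k l n} → k ℕ.⊔ l ℕ.≤ n → l ℕ.≤ n
    ⊔₂ {k} {l} = ℕ.≤-trans (ℕ.m≤n⊔m k l)

  pointwise⇒≈ : ∀ {x y} → (∀ n → seq x n ≡ seq y n) → x ≈ y
  pointwise⇒≈ {x} {y} eq = mk≈ λ ε ε>0 → 0 , λ n _ →
    subst (ℚ._< ε) (sym (trans (cong (λ t → ∣ t ℚ.- seq y n ∣) (eq n)) (∣self∣ (seq y n)))) ε>0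

  ≈-sym : ∀ {x y} → x ≈ y → y ≈ x
  ≈-sym {x} {y} x≈y = mk≈ λ ε ε>0 → let N , p = close x≈y ε ε>0 in
    N , λ n N≤n → subst (ℚ._< ε) (∣swap∣ (seq x n) (seq y n)) (p n N≤n)

  ≈-trans : ∀ {x y z} → x ≈ y → y ≈ z → x ≈ z
  ≈-trans {x} {y} {z} x≈y y≈z = mk≈ λ ε ε>0 →
    let K , p = close x≈y (½ ℚ.* ε) (half>0 ε>0)
        L , q = close y≈z (½ ℚ.* ε) (half>0 ε>0)
    in K ℕ.⊔ L , λ n ≤n →
       triangle-close (seq x n) (seq y n) (seq z n) (p n (⊔₁ ≤n)) (q n (⊔₂ {K} ≤n))

  fromℚ : ℚ → ℝ
  fromℚ q = mkℝ (λ _ → q) λ ε ε>0 → 0 , λ _ _ _ _ → subst (ℚ._< ε) (sym (∣self∣ q)) ε>0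

  infixl 6 _+_
  infixl 7 _*_
  infix  8 -_

  -- Abstract, to keep these proofs from being unfolded during conversion checking.
  abstract
    +-cauchy : ∀ x y → Cauchy (λ n → seq x n ℚ.+ seq y n)
    +-cauchy x y ε ε>0 =
      let K , p = cauchy x (½ ℚ.* ε) (half>0 ε>0)
          L , q = cauchy y (½ ℚ.* ε) (half>0 ε>0)
      in K ℕ.⊔ L , λ m n ≤m ≤n →
         +-close (seq x m) (seq y m) (seq x n) (seq y n)
           (p m n (⊔₁ ≤m) (⊔₁ ≤n)) (q m n (⊔₂ {K} ≤m) (⊔₂ {K} ≤n))

    neg-cauchy : ∀ x → Cauchy (λ n → ℚ.- seq x n)
    neg-cauchy x ε ε>0 =
      let N , p = cauchy x ε ε>0
      in N , λ m n ≤m ≤n → neg-close (seq x m) (seq x n) (p m n ≤m ≤n)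

    *-cauchy : ∀ x y → Cauchy (λ n → seq x n ℚ.* seq y n)
    *-cauchy x y ε ε>0 =
      let A , I , x<A = bounded x
          D , J , y<D = bounded y
          δ , δ>0 , eq = divide {A ℚ.+ D}
            (pos-bounds {seq x I} {seq y J} (x<A I ℕ.≤-refl) (y<D J ℕ.≤-refl)) ε>0
          K , p = cauchy x δ δ>0
          L , q = cauchy y δ δ>0
      in (I ℕ.⊔ J) ℕ.⊔ (K ℕ.⊔ L) , λ m n ≤m ≤n →
         *-close (seq x m) (seq y m) (seq x n) (seq y n)
           (x<A m (⊔₁ (⊔₁ ≤m))) (y<D n (⊔₂ {I} (⊔₁ ≤n))) eq
           (p m n (⊔₁ (⊔₂ {I ℕ.⊔ J} ≤m)) (⊔₁ (⊔₂ {I ℕ.⊔ J} ≤n)))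
           (q m n (⊔₂ {K} (⊔₂ {I ℕ.⊔ J} ≤m)) (⊔₂ {K} (⊔₂ {I ℕ.⊔ J} ≤n)))

  _+_ : ℝ → ℝ → ℝ
  x + y = mkℝ (λ n → seq x n ℚ.+ seq y n) (+-cauchy x y)

  -_ : ℝ → ℝ
  - x = mkℝ (λ n → ℚ.- seq x n) (neg-cauchy x)

  _*_ : ℝ → ℝ → ℝ
  x * y = mkℝ (λ n → seq x n ℚ.* seq y n) (*-cauchy x y)

  +-cong : ∀ {x x′ y y′} → x ≈ x′ → y ≈ y′ → x + y ≈ x′ + y′
  +-cong {x} {x′} {y} {y′} x≈ y≈ = mk≈ λ ε ε>0 →
    let K , p = close x≈ (½ ℚ.* ε) (half>0 ε>0)
        L , q = close y≈ (½ ℚ.* ε) (half>0 ε>0)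
    in K ℕ.⊔ L , λ n ≤n →
       +-close (seq x n) (seq y n) (seq x′ n) (seq y′ n) (p n (⊔₁ ≤n)) (q n (⊔₂ {K} ≤n))

  -‿cong : ∀ {x y} → x ≈ y → - x ≈ - y
  -‿cong {x} {y} x≈y = mk≈ λ ε ε>0 → let N , p = close x≈y ε ε>0 in
    N , λ n ≤n → neg-close (seq x n) (seq y n) (p n ≤n)

  *-cong : ∀ {x x′ y y′} → x ≈ x′ → y ≈ y′ → x * y ≈ x′ * y′
  *-cong {x} {x′} {y} {y′} x≈ y≈ = mk≈ λ ε ε>0 →
    let A , I , x<A = bounded x
        D , J , y′<D = bounded y′
        δ , δ>0 , eq = divide {A ℚ.+ D}
          (pos-bounds {seq x I} {seq y′ J} (x<A I ℕ.≤-refl) (y′<D J ℕ.≤-refl)) ε>0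
        K , p = close x≈ δ δ>0
        L , q = close y≈ δ δ>0
    in (I ℕ.⊔ J) ℕ.⊔ (K ℕ.⊔ L) , λ n ≤n →
       *-close (seq x n) (seq y n) (seq x′ n) (seq y′ n)
         (x<A n (⊔₁ (⊔₁ ≤n))) (y′<D n (⊔₂ {I} (⊔₁ ≤n))) eq
         (p n (⊔₁ (⊔₂ {I ℕ.⊔ J} ≤n))) (q n (⊔₂ {K} (⊔₂ {I ℕ.⊔ J} ≤n)))

------------------------------------------------------------------------

module Complex where

  open Real using (ℝ; seq; fromℚ)

  infix 4 _≈_
  infixl 6 _+_
  infixl 7 _*_
  infix  8 -_

  record ℂ : Set where
    no-eta-equality
    constructor _+i_
    field
      re : ℝ
      im : ℝ

  open ℂ public

  record _≈_ (z w : ℂ) : Set where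
    constructor mk≈
    field
      re-≈ : re z Real.≈ re w
      im-≈ : im z Real.≈ im w

  open _≈_ public

  _+_ : ℂ → ℂ → ℂ
  z + w = (re z Real.+ re w) +i (im z Real.+ im w)

  -_ : ℂ → ℂ
  - z = (Real.- re z) +i (Real.- im z)

  _*_ : ℂ → ℂ → ℂ
  z * w = (re z Real.* re w Real.+ Real.- (im z Real.* im w)) +i
          (re z Real.* im w Real.+ im z Real.* re w)

  0ℂ : ℂ
  0ℂ = fromℚ 0ℚ +i fromℚ 0ℚ

  1ℂ : ℂ
  1ℂ = fromℚ 1ℚ +i fromℚ 0ℚ

  private
    pw : ∀ {z w} → (∀ n → seq (re z) n ≡ seq (re w) n) →
         (∀ n → seq (im z) n ≡ seq (im w) n) → z ≈ w
    pw p q = mk≈ (Real.pointwise⇒≈ p) (Real.pointwise⇒≈ q)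

    open +-*-Solver

    *-comm : ∀ z w → z * w ≈ w * z
    *-comm z w = pw
      (λ n → solve 4 (λ a b c d → a :* c :+ :- (b :* d) := c :* a :+ :- (d :* b)) refl
        (seq (re z) n) (seq (im z) n) (seq (re w) n) (seq (im w) n))
      (λ n → solve 4 (λ a b c d → a :* d :+ b :* c := c :* b :+ d :* a) refl
        (seq (re z) n) (seq (im z) n) (seq (re w) n) (seq (im w) n))

    *-assoc : ∀ z w v → (z * w) * v ≈ z * (w * v)
    *-assoc z w v = pw
      (λ n → solve 6 (λ a b c d e f →
          (a :* c :+ :- (b :* d)) :* e :+ :- ((a :* d :+ b :* c) :* f)
        := a :* (c :* e :+ :- (d :* f)) :+ :- (b :* (c :* f :+ d :* e))) refl
        (seq (re z) n) (seq (im z) n) (seq (re w) n) (seq (im w) n)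
        (seq (re v) n) (seq (im v) n))
      (λ n → solve 6 (λ a b c d e f →
          (a :* c :+ :- (b :* d)) :* f :+ (a :* d :+ b :* c) :* e
        := a :* (c :* f :+ d :* e) :+ b :* (c :* e :+ :- (d :* f))) refl
        (seq (re z) n) (seq (im z) n) (seq (re w) n) (seq (im w) n)
        (seq (re v) n) (seq (im v) n))

    *-identityˡ : ∀ z → 1ℂ * z ≈ z
    *-identityˡ z = pw
      (λ n → solve 2 (λ a b → con 1ℚ :* a :+ :- (con 0ℚ :* b) := a) refl
        (seq (re z) n) (seq (im z) n))
      (λ n → solve 2 (λ a b → con 1ℚ :* b :+ con 0ℚ :* a := b) refl
        (seq (re z) n) (seq (im z) n))

    distribˡ : ∀ z w v → z * (w + v) ≈ z * w + z * v
    distribˡ z w v = pw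
      (λ n → solve 6 (λ a b c d e f →
          a :* (c :+ e) :+ :- (b :* (d :+ f))
        := (a :* c :+ :- (b :* d)) :+ (a :* e :+ :- (b :* f))) refl
        (seq (re z) n) (seq (im z) n) (seq (re w) n) (seq (im w) n)
        (seq (re v) n) (seq (im v) n))
      (λ n → solve 6 (λ a b c d e f →
          a :* (d :+ f) :+ b :* (c :+ e)
        := (a :* d :+ b :* c) :+ (a :* f :+ b :* e)) refl
        (seq (re z) n) (seq (im z) n) (seq (re w) n) (seq (im w) n)
        (seq (re v) n) (seq (im v) n))

    ≈-refl : ∀ {z} → z ≈ z
    ≈-refl = pw (λ _ → refl) (λ _ → refl)

    ≈-trans : ∀ {z w v} → z ≈ w → w ≈ v → z ≈ v
    ≈-trans (mk≈ p q) (mk≈ r s) = mk≈ (Real.≈-trans p r) (Real.≈-trans q s)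

    ≈-sym : ∀ {z w} → z ≈ w → w ≈ z
    ≈-sym (mk≈ p q) = mk≈ (Real.≈-sym p) (Real.≈-sym q)

    +-cong : ∀ {z z′ w w′} → z ≈ z′ → w ≈ w′ → z + w ≈ z′ + w′
    +-cong (mk≈ p q) (mk≈ r s) = mk≈ (Real.+-cong p r) (Real.+-cong q s)

    *-cong : ∀ {z z′ w w′} → z ≈ z′ → w ≈ w′ → z * w ≈ z′ * w′
    *-cong (mk≈ p q) (mk≈ r s) = mk≈
      (Real.+-cong (Real.*-cong p r) (Real.-‿cong (Real.*-cong q s)))
      (Real.+-cong (Real.*-cong p s) (Real.*-cong q r))

    +-comm : ∀ z w → z + w ≈ w + z
    +-comm z w = pw (λ n → ℚ.+-comm (seq (re z) n) (seq (re w) n))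
                    (λ n → ℚ.+-comm (seq (im z) n) (seq (im w) n))

    +-identityˡ : ∀ z → 0ℂ + z ≈ z
    +-identityˡ z = pw (λ n → ℚ.+-identityˡ (seq (re z) n))
                       (λ n → ℚ.+-identityˡ (seq (im z) n))

    -‿inverseˡ : ∀ z → - z + z ≈ 0ℂ
    -‿inverseˡ z = pw (λ n → ℚ.+-inverseˡ (seq (re z) n))
                      (λ n → ℚ.+-inverseˡ (seq (im z) n))

    +-assoc : ∀ z w v → (z + w) + v ≈ z + (w + v)
    +-assoc z w v = pw (λ n → ℚ.+-assoc (seq (re z) n) (seq (re w) n) (seq (re v) n))
                       (λ n → ℚ.+-assoc (seq (im z) n) (seq (im w) n) (seq (im v) n))

    +-identityʳ : ∀ z → z + 0ℂ ≈ z
    +-identityʳ z = pw (λ n → ℚ.+-identityʳ (seq (re z) n))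
                       (λ n → ℚ.+-identityʳ (seq (im z) n))

    -‿inverseʳ : ∀ z → z + - z ≈ 0ℂ
    -‿inverseʳ z = pw (λ n → ℚ.+-inverseʳ (seq (re z) n))
                      (λ n → ℚ.+-inverseʳ (seq (im z) n))

    -‿cong : ∀ {z w} → z ≈ w → - z ≈ - w
    -‿cong (mk≈ p q) = mk≈ (Real.-‿cong p) (Real.-‿cong q)

    *-identityʳ : ∀ z → z * 1ℂ ≈ z
    *-identityʳ z = ≈-trans (*-comm z 1ℂ) (*-identityˡ z)

    distribʳ : ∀ z w v → (w + v) * z ≈ w * z + v * z
    distribʳ z w v = ≈-trans (*-comm (w + v) z)
      (≈-trans (distribˡ z w v) (+-cong (*-comm z w) (*-comm z v)))

  +-*-isCommutativeRing : IsCommutativeRing _≈_ _+_ _*_ -_ 0ℂ 1ℂ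
  +-*-isCommutativeRing = record
    { isRing = record
      { +-isAbelianGroup = record
        { isGroup = record
          { isMonoid = record
            { isSemigroup = record
              { isMagma = record
                { isEquivalence = record { refl = ≈-refl ; sym = ≈-sym ; trans = ≈-trans }
                ; ∙-cong = +-cong
                }
              ; assoc = +-assoc
              }
            ; identity = +-identityˡ , +-identityʳ
            }
          ; inverse = -‿inverseˡ , -‿inverseʳ
          ; ⁻¹-cong = -‿cong
          }
        ; comm = +-comm
        }
      ; *-cong = *-cong
      ; *-assoc = *-assoc
      ; *-identity = *-identityˡ , *-identityʳ
      ; distrib = distribˡ , distribʳ
      }
    ; *-comm = *-comm
    }

  commutativeRing : CommutativeRing 0ℓ 0ℓ
  commutativeRing = record { isCommutativeRing = +-*-isCommutativeRing }

open Complex public using (ℂ)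
open CommutativeRing Complex.commutativeRing public
  using (_≈_; _≉_; _+_; _*_; -_; 0#; 1#)
open import Algebra.Properties.Semiring.Exp
  (CommutativeRing.semiring Complex.commutativeRing) public using (_^_)

------------------------------------------------------------------------
-- Finite subsets of ℕ, as strictly increasing lists. Each set has a single
-- representative (⊆-antisym), so functions out of 𝓕 need not be required to
-- respect an equivalence.

𝓕 : Set
𝓕 = List# ℕ ℕ._<_

open FreshMembership (setoid ℕ) public using () renaming (_∈_ to _∈_)

infix 4 _⊆_ _#_

_#_ : ℕ → 𝓕 → Set
a # x = Fresh._#_ {R = ℕ._<_} a x

_⊆_ : 𝓕 → 𝓕 → Set
x ⊆ y = ∀ {n} → n ∈ x → n ∈ y

card : 𝓕 → ℕ
card = Fresh.length

#-irrelevant : ∀ {a} (x : 𝓕) (p q : a # x) → p ≡ q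
#-irrelevant []           _       _       = refl
#-irrelevant (cons _ x _) (p , r) (q , s) = cong₂ _,_ (ℕ.<-irrelevant p q) (#-irrelevant x r s)

cons-cong : ∀ {a b} {x y : 𝓕} {p : a # x} {q : b # y} → a ≡ b → x ≡ y → cons a x p ≡ cons b y q
cons-cong {x = x} {p = p} {q} refl refl = cong (cons _ x) (#-irrelevant x p q)

#⇒< : ∀ {a n} (x : 𝓕) → a # x → n ∈ x → a ℕ.< n
#⇒< (cons _ x _) (a<b , _)   (here refl)  = a<b
#⇒< (cons _ x _) (_   , a#x) (there n∈x) = #⇒< x a#x n∈x

<⇒# : ∀ {a} (x : 𝓕) → (∀ {n} → n ∈ x → a ℕ.< n) → a # x
<⇒# []           _ = _
<⇒# (cons _ x _) h = h (here refl) , <⇒# x (λ n∈x → h (there n∈x))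

⊆-tail : ∀ {a b} {x y : 𝓕} {p : a # x} {q : b # y} →
         b ℕ.≤ a → cons a x p ⊆ cons b y q → x ⊆ y
⊆-tail {x = x} {p = p} b≤a sub n∈x with sub (there n∈x)
... | here refl  = contradiction b≤a (ℕ.<⇒≱ (#⇒< x p n∈x))
... | there n∈y = n∈y

head-≤ : ∀ {a b} {x y : 𝓕} {p : a # x} {q : b # y} → cons a x p ⊆ cons b y q → b ℕ.≤ a
head-≤ {y = y} {q = q} sub with sub (here refl)
... | here refl  = ℕ.≤-refl
... | there a∈y = ℕ.<⇒≤ (#⇒< y q a∈y)

⊆-antisym : ∀ {x y} → x ⊆ y → y ⊆ x → x ≡ y
⊆-antisym {[]}         {[]}         _   _   = refl
⊆-antisym {[]}         {cons _ _ _} _   y⊆x with () ← y⊆x (here refl)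
⊆-antisym {cons _ _ _} {[]}         x⊆y _   with () ← x⊆y (here refl)
⊆-antisym {cons a x p} {cons b y q} x⊆y y⊆x =
  cons-cong (ℕ.≤-antisym (head-≤ y⊆x) (head-≤ x⊆y))
            (⊆-antisym (⊆-tail {p = p} {q} (head-≤ x⊆y) x⊆y)
                       (⊆-tail {p = q} {p} (head-≤ y⊆x) y⊆x))

-- The subsets of {a} ∪ y are the subsets of y, and the sets {a} ∪ x for x ⊆ y.
mutual
  subsets : 𝓕 → List 𝓕
  subsets []             = [] ∷ []
  subsets (cons a y a#y) = subsets y ++ All.reduce (cons a _) (subsets-# y a#y)

  subsets-# : ∀ {a} (y : 𝓕) → a # y → All (a #_) (subsets y)
  subsets-# []             _           = _ ∷ []
  subsets-# (cons b y b#y) (a<b , a#y) =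
    All.++⁺ (subsets-# y a#y) (reduce-# a<b (subsets-# y a#y) (subsets-# y b#y))

  reduce-# : ∀ {a b xs} → a ℕ.< b → All (a #_) xs → (ps : All (b #_) xs) →
             All (a #_) (All.reduce (cons b _) ps)
  reduce-# a<b []       []       = []
  reduce-# a<b (q ∷ qs) (p ∷ ps) = (a<b , q) ∷ reduce-# a<b qs ps

-- Adequacy: subsets y lists each x ⊆ y exactly once.

private
  ∈-reduce⁺ : ∀ {a x xs} (ps : All (a #_) xs) (p : a # x) →
              x ∈ₗ xs → cons a x p ∈ₗ All.reduce (cons a _) ps
  ∈-reduce⁺ (q ∷ ps) p (here refl)  = here (cons-cong refl refl)
  ∈-reduce⁺ (q ∷ ps) p (there x∈xs) = there (∈-reduce⁺ ps p x∈xs)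

  ∈-reduce⁻ : ∀ {a} {z : 𝓕} {xs : List 𝓕} (ps : All (a #_) xs) → z ∈ₗ All.reduce (cons a _) ps →
              Σ 𝓕 λ x → x ∈ₗ xs × Σ (a # x) λ p → z ≡ cons a x p
  ∈-reduce⁻ (p ∷ ps) (here refl) = _ , here refl , p , refl
  ∈-reduce⁻ (p ∷ ps) (there z∈)  = let x , x∈ , q , eq = ∈-reduce⁻ ps z∈ in x , there x∈ , q , eq

  cons-injectiveʳ : ∀ {a b} {x y : 𝓕} {p : a # x} {q : b # y} → cons a x p ≡ cons b y q → x ≡ y
  cons-injectiveʳ refl = refl

  unique-reduce : ∀ {a xs} (ps : All (a #_) xs) → Unique xs → Unique (All.reduce (cons a _) ps)
  unique-reduce []       []         = []
  unique-reduce {a} (p ∷ ps) (x∉ ∷ u) = All.tabulate (λ z∈ eq →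
      let _ , y∈ , _ , eq′ = ∈-reduce⁻ ps z∈
      in All.lookup x∉ y∈ (cons-injectiveʳ (trans eq eq′)))
    ∷ unique-reduce ps u

∈-subsets⁺ : ∀ {x y} → x ⊆ y → x ∈ₗ subsets y
∈-subsets⁺ {[]}         {[]}           _   = here refl
∈-subsets⁺ {cons _ _ _} {[]}           x⊆y with () ← x⊆y (here refl)
∈-subsets⁺ {[]}         {cons b y b#y} _   = ∈-++⁺ˡ (∈-subsets⁺ {[]} {y} λ ())
∈-subsets⁺ {cons a x p} {cons b y b#y} x⊆y with x⊆y (here refl)
... | here refl  = ∈-++⁺ʳ (subsets y) (∈-reduce⁺ (subsets-# y b#y) p
                     (∈-subsets⁺ {x} {y} (⊆-tail {p = p} {b#y} ℕ.≤-refl x⊆y)))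
... | there a∈y = ∈-++⁺ˡ (∈-subsets⁺ {cons a x p} {y} λ
  { (here refl)  → a∈y
  ; (there n∈x) → ⊆-tail {p = p} {b#y} (head-≤ x⊆y) x⊆y n∈x })

∈-subsets⁻ : ∀ {x} y → x ∈ₗ subsets y → x ⊆ y
∈-subsets⁻ []             (here refl) ()
∈-subsets⁻ (cons b y b#y) x∈ n∈x with ∈-++⁻ (subsets y) x∈
... | inj₁ x∈ˡ = there (∈-subsets⁻ y x∈ˡ n∈x)
... | inj₂ x∈ʳ with ∈-reduce⁻ (subsets-# y b#y) x∈ʳ | n∈x
...   | _ , _   , _ , refl | here refl  = here refl
...   | _ , x′∈ , _ , refl | there n∈x′ = there (∈-subsets⁻ y x′∈ n∈x′)

subsets-unique : ∀ y → Unique (subsets y)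
subsets-unique []             = [] ∷ []
subsets-unique (cons b y b#y) = Unique.++⁺ (subsets-unique y)
  (unique-reduce (subsets-# y b#y) (subsets-unique y))
  λ { (z∈ˡ , z∈ʳ) → disjoint z∈ˡ (∈-reduce⁻ (subsets-# y b#y) z∈ʳ) }
  where
  disjoint : ∀ {z} → z ∈ₗ subsets y →
             ¬ (Σ 𝓕 λ x → x ∈ₗ subsets y × Σ (b # x) λ p → z ≡ cons b x p)
  disjoint z∈ (_ , _ , _ , refl) = ℕ.<-irrefl refl (#⇒< y b#y (∈-subsets⁻ y z∈ (here refl)))

∑-subsets : 𝓕 → (𝓕 → ℂ) → ℂ
∑-subsets y h = foldr _+_ 0# (map h (subsets y))

infix 5 ∑-subsets

syntax ∑-subsets y (λ x → e) = ∑[ x ⊆ y ] e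

------------------------------------------------------------------------

support : (𝓕 → ℂ) → Pred 𝓕 0ℓ
support h x = h x ≉ 0#

-- Finite: all members occur in some finite list. Classically the list can be
-- pruned to an exact enumeration of P; constructively that pruning needs P to be
-- decidable, which supports of complex functions are not, so this is the weaker
-- hypothesis and ¬ Finite the stronger conclusion.
Finite : Pred 𝓕 0ℓ → Set
Finite P = ∃ λ xs → ∀ {x} → P x → x ∈ₗ xs

{-# OPTIONS --safe #-}

-- The inversion formula is an induction on y: the subsets of {b} ∪ y pair up as
-- x, {b} ∪ x with x ⊆ y, and the paired terms have opposite signs, so only
-- g({b} ∪ x) − g(x) = ∑_{z ⊆ x} f({b} ∪ z) survives.
--
-- If both supports were finite, choose, for a given y, some a lying neither in y nor
-- in any set of either support. Then f vanishes on the subsets of {a} ∪ y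
-- that contain a, so g(y) = g({a} ∪ y) = 0. Hence g = 0, and f = 0 by inversion.
-- Membership in the supports is only refuted, never decided; this suffices because
-- equality of Cauchy reals is ¬¬-stable.
module Submission where

open import Defs hiding (_≈_; _≉_; _+_; _*_; -_; 0#; 1#; _^_)
open import Algebra.Bundles using (CommutativeRing)
import Algebra.Properties.CommutativeSemigroup as CommutativeSemigroupProperties
import Algebra.Properties.Ring as RingProperties
import Algebra.Properties.Semiring.Exp as SemiringExp
open import Data.List.Base using (List; []; _∷_; _++_; map; foldr)
open import Data.List.Fresh using (module List#)
open import Data.List.Fresh.Relation.Unary.Any using (here; there)
open import Data.List.Membership.Propositional using () renaming (_∈_ to _∈ₗ_)
open import Data.List.Membership.Propositional.Properties using (∈-++⁺ˡ; ∈-++⁺ʳ)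
open import Data.List.Relation.Unary.All using (All; []; _∷_; reduce)
open import Data.List.Relation.Unary.Any using (here; there)
open import Data.Nat.Base as ℕ using (ℕ; suc; _∸_; z≤n; s≤s)
import Data.Nat.Properties as ℕ
open import Data.Product.Base using (∃; _×_; _,_)
open import Data.Rational.Base as ℚ using (ℚ; 0ℚ; 1ℚ; ½; ∣_∣)
import Data.Rational.Properties as ℚ
open import Data.Rational.Solver using (module +-*-Solver)
open import Data.Sum.Base using (_⊎_; inj₁; inj₂)
open import Function.Base using (_∘_)
open import Level using (0ℓ)
open import Relation.Binary.Definitions using (tri<; tri≈; tri>)
open import Relation.Binary.PropositionalEquality as ≡ using (_≡_)
open import Relation.Nullary.Decidable.Core using (yes; no; from-yes)
open import Relation.Nullary.Negation.Core using (¬_; contradiction)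
open List# using ([]; cons)

-- Stability of equality

∣p+q∣<ε : ∀ {ε} p q → ∣ p ∣ ℚ.< ½ ℚ.* ε → ∣ q ∣ ℚ.< ½ ℚ.* ε → ∣ p ℚ.+ q ∣ ℚ.< ε
∣p+q∣<ε {ε} p q p< q< = ℚ.≤-<-trans (ℚ.∣p+q∣≤∣p∣+∣q∣ p q)
  (≡.subst (∣ p ∣ ℚ.+ ∣ q ∣ ℚ.<_)
    (≡.trans (≡.sym (ℚ.*-distribʳ-+ ε ½ ½)) (ℚ.*-identityˡ ε)) (ℚ.+-mono-< p< q<))

0<½*ε : ∀ {ε} → 0ℚ ℚ.< ε → 0ℚ ℚ.< ½ ℚ.* ε
0<½*ε {ε} ε>0 = ≡.subst (ℚ._< ½ ℚ.* ε) (ℚ.*-zeroʳ ½) (ℚ.*-monoʳ-<-pos ½ ε>0)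

-- A Cauchy sequence that comes close to its limit at one sufficiently late index
-- stays close, so closeness can be tested at that index.
ℝ-≈-stable : ∀ {x y} → ¬ ¬ (x Real.≈ y) → x Real.≈ y
ℝ-≈-stable {x} {y} ¬¬x≈y = Real.mk≈ λ ε ε>0 → close ε (0<½*ε ε>0)
  where
  d : ℕ → ℚ
  d n = Real.seq x n ℚ.- Real.seq y n

  split : ∀ m n → (d m ℚ.- d n) ℚ.+ d n ≡ d m
  split m n = solve 2 (λ a b → (a :- b) :+ b := a) ≡.refl (d m) (d n)
    where open +-*-Solver

  close : ∀ ε → 0ℚ ℚ.< ½ ℚ.* ε → ∃ λ N → ∀ n → N ℕ.≤ n → ∣ d n ∣ ℚ.< ε
  -- From `N` on, `d` varies by less than `ε`/4. The comparison of `d N` with `ε`/2 is between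
  -- rationals, hence decidable.
  close ε ½ε>0 with Real.+-cauchy x (Real.- y) (½ ℚ.* (½ ℚ.* ε)) (0<½*ε ½ε>0)
  ... | N , cauchy with ∣ d N ∣ ℚ.<? ½ ℚ.* ε
  ...   | yes dN< = N , λ n N≤n → ≡.subst (λ t → ∣ t ∣ ℚ.< ε) (split n N)
          (∣p+q∣<ε (d n ℚ.- d N) (d N)
            (ℚ.<-trans (cauchy n N N≤n ℕ.≤-refl) quarter<half) dN<)
    where
    quarter<half : ½ ℚ.* (½ ℚ.* ε) ℚ.< ½ ℚ.* ε
    quarter<half = ≡.subst (½ ℚ.* (½ ℚ.* ε) ℚ.<_) (ℚ.*-identityˡ (½ ℚ.* ε))
      (ℚ.*-monoˡ-<-pos (½ ℚ.* ε) {{ℚ.positive ½ε>0}} (from-yes (½ ℚ.<? 1ℚ)))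
  -- An actual `x ≈ y` would give |`d N`| < `ε`/4 + `ε`/4 by way of a later index, so this case
  -- contradicts the double negation.
  ...   | no dN≮ = contradiction (λ x≈y →
            let K , p = Real.close x≈y (½ ℚ.* (½ ℚ.* ε)) (0<½*ε ½ε>0)
                n = N ℕ.⊔ K
            in dN≮ (≡.subst (λ t → ∣ t ∣ ℚ.< ½ ℚ.* ε) (split N n)
                 (∣p+q∣<ε (d N ℚ.- d n) (d n)
                   (cauchy N n ℕ.≤-refl (ℕ.m≤m⊔n N K)) (p n (ℕ.m≤n⊔m N K)))))
          ¬¬x≈y

-- Insertion into finite sets

#-trans : ∀ {a b} (x : 𝓕) → a ℕ.< b → b # x → a # x
#-trans x a<b b#x = <⇒# x λ n∈x → ℕ.<-trans a<b (#⇒< x b#x n∈x)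

mutual
  -- Total, unlike `cons`, so that `h ∘ insert a` is again a function on `𝓕` to which an induction
  -- hypothesis applies.
  insert : ℕ → 𝓕 → 𝓕
  insert a []           = cons a [] _
  insert a (cons b x p) with ℕ.<-cmp a b
  ... | tri< a<b _ _ = cons a (cons b x p) (a<b , #-trans x a<b p)
  ... | tri≈ _ _ _   = cons b x p
  ... | tri> _ _ b<a = cons b (insert a x) (#-insert x b<a p)

  #-insert : ∀ {a b} x → b ℕ.< a → b # x → b # insert a x
  #-insert         []           b<a _ = b<a , _
  #-insert {a} {b} (cons c x p) b<a (b<c , b#x) with ℕ.<-cmp a c
  ... | tri< _ _ _ = b<a , b<c , b#x
  ... | tri≈ _ _ _ = b<c , b#x
  ... | tri> _ _ _ = b<c , #-insert x b<a b#x

∈-insert : ∀ a x → a ∈ insert a x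
∈-insert a []           = here ≡.refl
∈-insert a (cons b x p) with ℕ.<-cmp a b
... | tri< _ _ _   = here ≡.refl
... | tri≈ _ a≡b _ = here a≡b
... | tri> _ _ _   = there (∈-insert a x)

⊆-insert : ∀ a x → x ⊆ insert a x
⊆-insert a (cons b x p) n∈ with ℕ.<-cmp a b
⊆-insert a (cons b x p) n∈           | tri< _ _ _ = there n∈
⊆-insert a (cons b x p) n∈           | tri≈ _ _ _ = n∈
⊆-insert a (cons b x p) (here n≡b)   | tri> _ _ _ = here n≡b
⊆-insert a (cons b x p) (there n∈x)  | tri> _ _ _ = there (⊆-insert a x n∈x)

∈-insert⁻ : ∀ {n} a x → n ∈ insert a x → n ≡ a ⊎ n ∈ x
∈-insert⁻ a []           (here n≡a) = inj₁ n≡a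
∈-insert⁻ a (cons b x p) n∈ with ℕ.<-cmp a b
∈-insert⁻ a (cons b x p) (here n≡a)  | tri< _ _ _ = inj₁ n≡a
∈-insert⁻ a (cons b x p) (there n∈)  | tri< _ _ _ = inj₂ n∈
∈-insert⁻ a (cons b x p) n∈          | tri≈ _ _ _ = inj₂ n∈
∈-insert⁻ a (cons b x p) (here n≡b)  | tri> _ _ _ = inj₂ (here n≡b)
∈-insert⁻ a (cons b x p) (there n∈)  | tri> _ _ _ with ∈-insert⁻ a x n∈
... | inj₁ n≡a = inj₁ n≡a
... | inj₂ n∈x = inj₂ (there n∈x)

insert-⊆ : ∀ {a x y} → a ∈ y → x ⊆ y → insert a x ⊆ y
insert-⊆ {a} {x} a∈y x⊆y n∈ with ∈-insert⁻ a x n∈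
... | inj₁ ≡.refl = a∈y
... | inj₂ n∈x    = x⊆y n∈x

insert≡cons : ∀ {a} x (a#x : a # x) → insert a x ≡ cons a x a#x
insert≡cons {a} x a#x = ⊆-antisym (insert-⊆ {y = cons a x a#x} (here ≡.refl) there)
  λ { (here ≡.refl) → ∈-insert a x ; (there n∈x) → ⊆-insert a x n∈x }

-- Both sides are the least set containing `a`, `b` and `x`; comparing members avoids cases on the
-- order of `a`, `b` and the entries of `x`.
insert-comm : ∀ a b x → insert a (insert b x) ≡ insert b (insert a x)
insert-comm a b x = ⊆-antisym (half a b) (half b a)
  where
  half : ∀ a b → insert a (insert b x) ⊆ insert b (insert a x)
  half a b = insert-⊆ (⊆-insert b (insert a x) (∈-insert a x))
    (insert-⊆ (∈-insert b (insert a x)) (⊆-insert b (insert a x) ∘ ⊆-insert a x))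

card-mono : ∀ {x y} → x ⊆ y → card x ℕ.≤ card y
card-mono {[]}         {_}          _   = z≤n
card-mono {cons _ _ _} {[]}         x⊆y with () ← x⊆y (here ≡.refl)
card-mono {cons a x p} {cons b y q} x⊆y =
  s≤s (card-mono (⊆-tail {p = p} {q} (head-≤ x⊆y) x⊆y))

#-⊆ : ∀ {a x y} → x ⊆ y → a # y → a # x
#-⊆ {x = x} {y} x⊆y a#y = <⇒# x (#⇒< y a#y ∘ x⊆y)

#⇒∉ : ∀ {a} x → a # x → ¬ a ∈ x
#⇒∉ x a#x a∈x = ℕ.<-irrefl ≡.refl (#⇒< x a#x a∈x)

-- Numbers outside finitely many sets

upperBound : (x : 𝓕) → ∃ λ a → ∀ {n} → n ∈ x → n ℕ.< a
upperBound []           = 0 , λ ()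
upperBound (cons b x p) = let a , <a = upperBound x in suc b ℕ.⊔ a , λ
  { (here ≡.refl) → ℕ.m≤m⊔n (suc b) a
  ; (there n∈x)   → ℕ.<-≤-trans (<a n∈x) (ℕ.m≤n⊔m (suc b) a) }

upperBounds : (xs : List 𝓕) → ∃ λ a → ∀ {x} → x ∈ₗ xs → ∀ {n} → n ∈ x → n ℕ.< a
upperBounds []       = 0 , λ ()
upperBounds (x ∷ xs) =
  let a , <a = upperBound x
      b , <b = upperBounds xs
  in a ℕ.⊔ b , λ
  { (here ≡.refl) n∈ → ℕ.<-≤-trans (<a n∈) (ℕ.m≤m⊔n a b)
  ; (there x∈)    n∈ → ℕ.<-≤-trans (<b x∈ n∈) (ℕ.m≤n⊔m a b) }

∃-avoiding : (xs : List 𝓕) → ∃ λ a → ∀ {x} → x ∈ₗ xs → ¬ a ∈ x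
∃-avoiding xs = let a , <a = upperBounds xs in a , λ x∈ a∈x → ℕ.<-irrefl ≡.refl (<a x∈ a∈x)

-- Sums over subsets

-- For an abstract ring, since the operations of ℂ unfold and defeat unification;
-- at ℂ, ∑ y h is definitionally ∑-subsets y h.
module SubsetSums {c} (R : CommutativeRing c 0ℓ) where
  open CommutativeRing R
  open CommutativeSemigroupProperties +-commutativeSemigroup using (interchange)
  open RingProperties ring using (-1*x≈-x)
  open SemiringExp semiring using (_^_)
  open import Relation.Binary.Reasoning.Setoid setoid

  sum : List 𝓕 → (𝓕 → Carrier) → Carrier
  sum xs h = foldr _+_ 0# (map h xs)

  ∑ : 𝓕 → (𝓕 → Carrier) → Carrier
  ∑ y h = sum (subsets y) h

  -- Recasts the recursion of `subsets` through `insert`, so that later inductions on `y` need not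
  -- handle lists or freshness proofs of subsets.
  ∑-cons : ∀ {b} y (b#y : b # y) h →
           ∑ (cons b y b#y) h ≈ ∑ y h + ∑ y (h ∘ insert b)
  ∑-cons {b} y b#y h = go (subsets y) (subsets-# y b#y)
    where
    sum-reduce : ∀ {xs} (ps : All (b #_) xs) →
                 sum (reduce (cons b _) ps) h ≈ sum xs (h ∘ insert b)
    sum-reduce []                 = refl
    sum-reduce (_∷_ {x = x} p ps) =
      +-cong (reflexive (≡.cong h (≡.sym (insert≡cons x p)))) (sum-reduce ps)

    -- The two lists are decoupled, so that the recursion can consume `xs` while `zs` stays fixed.
    go : ∀ xs {zs} (ps : All (b #_) zs) →
         sum (xs ++ reduce (cons b _) ps) h ≈ sum xs h + sum zs (h ∘ insert b)
    go []       ps = trans (sum-reduce ps) (sym (+-identityˡ _))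
    go (x ∷ xs) ps = trans (+-congˡ (go xs ps)) (sym (+-assoc _ _ _))

  ∑-cong : ∀ y {h k} → (∀ x → x ⊆ y → h x ≈ k x) → ∑ y h ≈ ∑ y k
  ∑-cong []             h≈k = +-congʳ (h≈k [] λ ())
  ∑-cong (cons b y b#y) {h} {k} h≈k = begin
    ∑ (cons b y b#y) h  ≈⟨ ∑-cons y b#y h ⟩
    ∑ y h + ∑ y (h ∘ insert b)
      ≈⟨ +-cong (∑-cong y λ x x⊆y → h≈k x (there ∘ x⊆y))
                (∑-cong y λ x x⊆y → h≈k (insert b x) (insert-⊆ (here ≡.refl) (there ∘ x⊆y))) ⟩
    ∑ y k + ∑ y (k ∘ insert b)  ≈⟨ ∑-cons y b#y k ⟨
    ∑ (cons b y b#y) k  ∎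

  ∑-+ : ∀ y h k → ∑ y (λ x → h x + k x) ≈ ∑ y h + ∑ y k
  ∑-+ []             h k = begin
    (h [] + k []) + 0#  ≈⟨ +-congˡ (+-identityˡ 0#) ⟨
    (h [] + k []) + (0# + 0#)  ≈⟨ interchange _ _ _ _ ⟩
    (h [] + 0#) + (k [] + 0#)  ∎
  ∑-+ (cons b y b#y) h k = begin
    ∑ (cons b y b#y) (λ x → h x + k x)  ≈⟨ ∑-cons y b#y _ ⟩
    ∑ y (λ x → h x + k x) + ∑ y (λ x → h (insert b x) + k (insert b x))
      ≈⟨ +-cong (∑-+ y h k) (∑-+ y (h ∘ insert b) (k ∘ insert b)) ⟩
    (∑ y h + ∑ y k) + (∑ y (h ∘ insert b) + ∑ y (k ∘ insert b))
      ≈⟨ interchange _ _ _ _ ⟩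
    (∑ y h + ∑ y (h ∘ insert b)) + (∑ y k + ∑ y (k ∘ insert b))
      ≈⟨ +-cong (∑-cons y b#y h) (∑-cons y b#y k) ⟨
    ∑ (cons b y b#y) h + ∑ (cons b y b#y) k ∎

  ∑-zero : ∀ y {h} → (∀ x → h x ≈ 0#) → ∑ y h ≈ 0#
  ∑-zero []             h≈0 = trans (+-identityʳ _) (h≈0 [])
  ∑-zero (cons b y b#y) {h} h≈0 = begin
    ∑ (cons b y b#y) h  ≈⟨ ∑-cons y b#y h ⟩
    ∑ y h + ∑ y (h ∘ insert b)  ≈⟨ +-cong (∑-zero y h≈0) (∑-zero y (h≈0 ∘ insert b)) ⟩
    0# + 0#  ≈⟨ +-identityˡ 0# ⟩
    0#  ∎

  -- Extends `∑-cons` to an `a` in any position: a head `b` below `a` is peeled off, and induction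
  -- is used for both `h` and `h ∘ insert b`.
  ∑-insert : ∀ a y h → ¬ a ∈ y →
             ∑ (insert a y) h ≈ ∑ y h + ∑ y (h ∘ insert a)
  ∑-insert a []             h _   = ∑-cons [] _ h
  ∑-insert a (cons b y b#y) h a∉ with ℕ.<-cmp a b
  ... | tri< a<b _ _   = ∑-cons (cons b y b#y) (a<b , #-trans y a<b b#y) h
  ... | tri≈ _ a≡b _   = contradiction (here a≡b) a∉
  ... | tri> _ _ b<a   = begin
    ∑ (cons b (insert a y) (#-insert y b<a b#y)) h
      ≈⟨ ∑-cons (insert a y) (#-insert y b<a b#y) h ⟩
    ∑ (insert a y) h + ∑ (insert a y) (h ∘ insert b)
      ≈⟨ +-cong (∑-insert a y h (a∉ ∘ there)) (∑-insert a y (h ∘ insert b) (a∉ ∘ there)) ⟩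
    (∑ y h + ∑ y (h ∘ insert a)) +
    (∑ y (h ∘ insert b) + ∑ y (h ∘ insert b ∘ insert a))
      ≈⟨ interchange _ _ _ _ ⟩
    (∑ y h + ∑ y (h ∘ insert b)) +
    (∑ y (h ∘ insert a) + ∑ y (h ∘ insert b ∘ insert a))
      ≈⟨ +-congˡ (+-congˡ (∑-cong y λ x _ → reflexive (≡.cong h (insert-comm b a x)))) ⟩
    (∑ y h + ∑ y (h ∘ insert b)) +
    (∑ y (h ∘ insert a) + ∑ y (h ∘ insert a ∘ insert b))
      ≈⟨ +-cong (∑-cons y b#y h) (∑-cons y b#y (h ∘ insert a)) ⟨
    ∑ (cons b y b#y) h + ∑ (cons b y b#y) (h ∘ insert a) ∎

  -- Möbius inversion

  möbius-inversion : ∀ y h →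
    h y ≈ ∑ y (λ x → (- 1#) ^ (card y ∸ card x) * ∑ x h)
  möbius-inversion []             h = sym (begin
    1# * (h [] + 0#) + 0#  ≈⟨ +-identityʳ _ ⟩
    1# * (h [] + 0#)  ≈⟨ *-identityˡ _ ⟩
    h [] + 0#  ≈⟨ +-identityʳ _ ⟩
    h []  ∎)
  möbius-inversion (cons b y b#y) h = begin
    h (cons b y b#y)  ≡⟨ ≡.cong h (insert≡cons y b#y) ⟨
    -- The hypothesis is taken at `h ∘ insert b`: its subset sums are what survives when the terms
    -- at `x` and `insert b x` are added.
    h (insert b y)  ≈⟨ möbius-inversion y (h ∘ insert b) ⟩
    ∑ y (λ x → sign x * ∑ x (h ∘ insert b))
                                      ≈⟨ ∑-cong y pair ⟨
    ∑ y (λ x → term x + term (insert b x))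
                                      ≈⟨ ∑-+ y term (term ∘ insert b) ⟩
    ∑ y term + ∑ y (term ∘ insert b)
                                      ≈⟨ ∑-cons y b#y term ⟨
    ∑ (cons b y b#y) term  ∎
    where
    sign term : 𝓕 → Carrier
    sign x = (- 1#) ^ (card y ∸ card x)
    term x = (- 1#) ^ (suc (card y) ∸ card x) * ∑ x h

    pair : ∀ x → x ⊆ y → term x + term (insert b x) ≈ sign x * ∑ x (h ∘ insert b)
    pair x x⊆y = begin
      term x + term (insert b x)
        -- As `card x ≤ card y`, the exponent in `term x` is one more than in `sign x`; at
        -- `insert b x` the two successors cancel, leaving `sign x`.
        ≈⟨ +-cong
             (*-congʳ (reflexive (≡.cong ((- 1#) ^_) (ℕ.+-∸-assoc 1 (card-mono x⊆y)))))
             (*-cong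
               (reflexive (≡.cong (λ z → (- 1#) ^ (suc (card y) ∸ card z)) (insert≡cons x b#x)))
               (∑-insert b x h (#⇒∉ x b#x))) ⟩
      (- 1# * sign x) * S + sign x * (S + T)
        ≈⟨ +-cong (trans (*-assoc _ _ _) (-1*x≈-x _)) (distribˡ _ _ _) ⟩
      - (sign x * S) + (sign x * S + sign x * T)
        ≈⟨ +-assoc _ _ _ ⟨
      (- (sign x * S) + sign x * S) + sign x * T
        ≈⟨ +-congʳ (-‿inverseˡ _) ⟩
      0# + sign x * T
        ≈⟨ +-identityˡ _ ⟩
      sign x * T ∎
      where
      b#x : b # x
      b#x = #-⊆ x⊆y b#y

      S T : Carrier
      S = ∑ x h
      T = ∑ x (h ∘ insert b)

  -- Functions with finite supports

  module _ (≈-stable : ∀ {z w} → ¬ ¬ z ≈ w → z ≈ w) {f g : 𝓕 → Carrier}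
           (g≈∑f : ∀ y → g y ≈ ∑ y f) where

    inversion : ∀ y → f y ≈ ∑ y (λ x → (- 1#) ^ (card y ∸ card x) * g x)
    inversion y = trans (möbius-inversion y f)
      (∑-cong y λ x _ → *-congˡ (sym (g≈∑f x)))

    finite-supports⇒g≈0 : Finite (λ x → ¬ f x ≈ 0#) → Finite (λ x → ¬ g x ≈ 0#) →
                          ∀ y → g y ≈ 0#
    finite-supports⇒g≈0 (xs , f-supp) (zs , g-supp) y =
      let a , avoids = ∃-avoiding (y ∷ xs ++ zs) in begin
      g y
        ≈⟨ g≈∑f y ⟩
      ∑ y f
        ≈⟨ +-identityʳ _ ⟨
      ∑ y f + 0#
        -- Were `f (insert a x)` nonzero, `insert a x` would be listed in `xs`, yet it contains `a`.
        ≈⟨ +-congˡ (∑-zero y λ x → ≈-stable λ f≉0 →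
             avoids (there (∈-++⁺ˡ (f-supp f≉0))) (∈-insert a x)) ⟨
      ∑ y f + ∑ y (f ∘ insert a)
        ≈⟨ ∑-insert a y f (avoids (here ≡.refl)) ⟨
      ∑ (insert a y) f
        ≈⟨ g≈∑f (insert a y) ⟨
      g (insert a y)
        ≈⟨ ≈-stable (λ g≉0 → avoids (there (∈-++⁺ʳ xs (g-supp g≉0))) (∈-insert a y)) ⟩
      0# ∎

    finite-supports⇒f≈0 : Finite (λ x → ¬ f x ≈ 0#) → Finite (λ x → ¬ g x ≈ 0#) →
                          ∀ y → f y ≈ 0#
    finite-supports⇒f≈0 f-fin g-fin y = trans (inversion y)
      (∑-zero y λ x → trans (*-congˡ (finite-supports⇒g≈0 f-fin g-fin x)) (zeroʳ _))

-- Specialisation to the complex numbers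

open Defs using (_≈_; _≉_; _+_; _*_; -_; 0#; 1#; _^_)

-- Refuting equality of either component already refutes `z ≈ w`, so stability reduces to that of
-- each real component.
≈-stable : ∀ {z w} → ¬ z ≉ w → z ≈ w
≈-stable ¬z≉w = Complex.mk≈
  (ℝ-≈-stable λ ¬re → ¬z≉w (¬re ∘ Complex.re-≈))
  (ℝ-≈-stable λ ¬im → ¬z≉w (¬im ∘ Complex.im-≈))

proposition3p2 : (f g : 𝓕 → ℂ) →
    ¬ (∀ y → f y ≈ 0#) →
    (∀ y → g y ≈ ∑[ x ⊆ y ] f x) →
    (∀ y → f y ≈ ∑[ x ⊆ y ] ((- 1#) ^ (card y ∸ card x) * g x)) ×
    ¬ (Finite (support f) × Finite (support g))
proposition3p2 f g f≢0 g≈∑f =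
  inversion ≈-stable g≈∑f ,
  λ (f-fin , g-fin) → f≢0 (finite-supports⇒f≈0 ≈-stable g≈∑f f-fin g-fin)
  where open SubsetSums Complex.commutativeRing
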